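{- Let $s_l=(a_j)$, $1\le j\le l$, be an ordered string of non-negative integers, and let $n$ be greater than or equal to the order of the Kyle graph associated with $s_l$. Then $\Delta(O_n(s_l))=2\,\delta(O_n(s_l))$.
   Context: An ordered string $s_l=(a_j)$, $1\le j\le l$ ($l\ge 1$), is an $l$-tuple of non-negative integers; $j$ is the index of the entry $a_j$. For a positive integer $n$, the ornated graph $O_n(s_l)$ is the (in general non-simple) directed graph on vertices $v_1,\dots,v_n$ whose arcs, counted with multiplicity, are the following: each odd-indexed entry $a_t$ contributes one arc $(v_i,v_j)$ for every pair $i<j$ with $i+a_t\ge j$; each even-indexed entry $a_s$ contributes one arc $(v_i,v_j)$ for every pair $i>j$ with $i-a_s\le j$. The degree of a vertex is $d(v)=d^+(v)+d^-(v)$ (out-degree plus in-degree, with multiplicity); $\Delta(O_n(s_l))$ and $\delta(O_n(s_l))$ are the maximum and minimum degree. The maximum possible degree associated with $s_l$ is $\max_{n\ge 1}\Delta(O_n(s_l))$. The Kyle graph associated with $s_l$ is the ornated graph $O_n(s_l)$ of smallest order $n$ that has a vertex of this maximum possible degree. -}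

module Defs where

open import Algebra.Properties.CommutativeMonoid.Sum using (sum)
open import Data.Bool.Base using (if_then_else_)
open import Data.Fin.Base using (Fin; zero; toℕ)
open import Data.List.Base using (tabulate)
open import Data.List.Extrema.Nat using (max; min)
open import Data.Nat.Base
  using (ℕ; suc; _+_; _∸_; _≤_; NonZero; parity)
open import Data.Nat.Properties
  using (_≤?_; _<?_; _>?_; +-0-commutativeMonoid)
open import Data.Parity.Base using (Parity; 0ℙ; 1ℙ)
open import Data.Product.Base using (Σ; ∃; _×_)
open import Data.Vec.Base using (Vec; lookup)
open import Relation.Binary.PropositionalEquality.Core using (_≡_)
open import Relation.Nullary.Decidable.Core using (does; _×-dec_)

∑ : ∀ {n} → (Fin n → ℕ) → ℕ
∑ = sum +-0-commutativeMonoid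

-- A directed multigraph on v₁, …, vₙ, given by arc multiplicities:
-- G u v is the number of arcs from u to v.
Multidigraph : ℕ → Set
Multidigraph n = Fin n → Fin n → ℕ

outDegree inDegree degree : ∀ {n} → Multidigraph n → Fin n → ℕ
outDegree G v = ∑ (λ w → G v w)
inDegree  G v = ∑ (λ u → G u v)
degree    G v = outDegree G v + inDegree G v

-- The first argument of max and min is included in the extremum; it is
-- itself the degree of a vertex, so no artificial default value enters.
Δ δ : ∀ {n} .{{_ : NonZero n}} → Multidigraph n → ℕ
Δ {suc _} G = max (degree G zero) (tabulate (degree G))
δ {suc _} G = min (degree G zero) (tabulate (degree G))

OrderedString : ℕ → Set
OrderedString l = Vec ℕ l

-- Fin counts from 0, whereas entries and vertices are numbered from 1.
index : ∀ {n} → Fin n → ℕ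
index x = suc (toℕ x)

-- The number (0 or 1) of arcs (vᵢ, vⱼ) contributed by an entry a whose
-- index has the given parity.  Truncated subtraction is harmless here:
-- when i < a, both i ∸ a ≤ j and the integer inequality i - a ≤ j hold.
contribution : Parity → (a i j : ℕ) → ℕ
contribution 1ℙ a i j = if does ((i <? j) ×-dec (j ≤? i + a)) then 1 else 0
contribution 0ℙ a i j = if does ((i >? j) ×-dec (i ∸ a ≤? j)) then 1 else 0

ornated : ∀ n {l} → OrderedString l → Multidigraph n
ornated n s u v =
  ∑ (λ t → contribution (parity (index t)) (lookup s t) (index u) (index v))

IsMaxPossibleDegree : ∀ {l} → OrderedString l → ℕ → Set
IsMaxPossibleDegree s D =
  (Σ ℕ λ n → Σ (NonZero n) λ n≢0 → Δ {{n≢0}} (ornated n s) ≡ D) ×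
  (∀ n .{{_ : NonZero n}} → Δ (ornated n s) ≤ D)

HasVertexOfDegree : ∀ {n} → Multidigraph n → ℕ → Set
HasVertexOfDegree G D = ∃ λ v → degree G v ≡ D

-- k is the order of the Kyle graph associated with s.  Such a k is
-- automatically positive, since ornated k s has a vertex.
IsKyleOrder : ∀ {l} → OrderedString l → ℕ → Set
IsKyleOrder s k = ∃ λ D →
  IsMaxPossibleDegree s D ×
  HasVertexOfDegree (ornated k s) D ×
  (∀ m → HasVertexOfDegree (ornated m s) D → k ≤ m)

{-# OPTIONS --safe #-}

-- Each entry a of s, of either parity, adds a ⊓ (i - 1) + a ⊓ (n - i) to
-- the degree of vᵢ in O_n(s).  Hence d(vᵢ) = r (i - 1) + r (n - i), where
-- r m = ∑ₜ aₜ ⊓ m is monotone and bounded by S = ∑ₜ aₜ, reaching S for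
-- large m; in particular the maximum possible degree is 2S.  If the Kyle
-- graph has a vertex of this degree with p vertices before and q after
-- it, then r p = r q = S.  When n > p + q, the vertex of O_n(s) with p
-- vertices before it still has degree 2S, every vertex has at least p
-- vertices before or q after it and hence degree at least S, and v₁ has
-- degree exactly r 0 + r (n - 1) = S.
module Submission where

open import Defs
open import Algebra.Properties.CommutativeMonoid.Sum
  using (sum-cong-≗; sum-replicate-zero; ∑-distrib-+; ∑-comm)
open import Data.Bool.Base using (if_then_else_; _∧_)
open import Data.Fin.Base using (Fin; zero; suc; toℕ; fromℕ<)
open import Data.Fin.Properties using (toℕ<n; toℕ-fromℕ<)
open import Data.List.Extrema.Nat using (xs≤max; max≈v⁺; min≈v⁺)
open import Data.List.Membership.Propositional.Properties using (∈-tabulate⁺)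
open import Data.List.Relation.Unary.All.Properties using (tabulate⁺; tabulate⁻)
open import Data.Nat.Base
  using (ℕ; zero; suc; _+_; _*_; _∸_; _⊓_; _≤_; _<_; _≥_; z≤n; s≤s; s≤s⁻¹;
         _<ᵇ_; NonZero; parity)
open import Data.Nat.Properties
open import Data.Parity.Base using (0ℙ; 1ℙ)
open import Data.Product.Base using (_,_; _×_; proj₁; proj₂)
open import Data.Sum.Base using (inj₁; inj₂)
open import Data.Vec.Base using (lookup)
open import Function.Bundles using (mk⇔)
open import Relation.Binary.PropositionalEquality
open import Relation.Nullary.Decidable using (does-⇔)

private
  variable
    l n : ℕ

∑-cong : {f g : Fin n → ℕ} → (∀ i → f i ≡ g i) → ∑ f ≡ ∑ g
∑-cong = sum-cong-≗ +-0-commutativeMonoid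

∑-zero : ∀ n → ∑ {n} (λ _ → 0) ≡ 0
∑-zero = sum-replicate-zero +-0-commutativeMonoid

∑-mono-≤ : {f g : Fin n → ℕ} → (∀ i → f i ≤ g i) → ∑ f ≤ ∑ g
∑-mono-≤ {zero}  f≤g = z≤n
∑-mono-≤ {suc n} f≤g = +-mono-≤ (f≤g zero) (∑-mono-≤ (λ i → f≤g (suc i)))

term≤∑ : (f : Fin n → ℕ) → ∀ i → f i ≤ ∑ f
term≤∑ f zero    = m≤m+n (f zero) _
term≤∑ f (suc i) = m≤n⇒m≤o+n (f zero) (term≤∑ (λ j → f (suc j)) i)

Δ≡degree : .{{_ : NonZero n}} (G : Multidigraph n) →
           ∀ v → (∀ w → degree G w ≤ degree G v) → Δ G ≡ degree G v
Δ≡degree {suc _} G v d≤dv =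
  max≈v⁺ (∈-tabulate⁺ {f = degree G} v) (tabulate⁺ d≤dv) (d≤dv zero)

δ≡degree : .{{_ : NonZero n}} (G : Multidigraph n) →
           ∀ v → (∀ w → degree G v ≤ degree G w) → δ G ≡ degree G v
δ≡degree {suc _} G v dv≤d =
  min≈v⁺ (∈-tabulate⁺ {f = degree G} v) (tabulate⁺ dv≤d) (dv≤d zero)

degree≤Δ : .{{_ : NonZero n}} (G : Multidigraph n) → ∀ v → degree G v ≤ Δ G
degree≤Δ {suc _} G = tabulate⁻ (xs≤max (degree G zero) _)

count-< : ∀ n a → ∑ {n} (λ j → if toℕ j <ᵇ a then 1 else 0) ≡ a ⊓ n
count-< zero    a       = sym (⊓-zeroʳ a)
count-< (suc n) zero    = ∑-zero n
count-< (suc n) (suc a) = cong suc (count-< n a)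

suc-⊓ : ∀ a m → a ⊓ suc m ≡ (if m <ᵇ a then 1 else 0) + a ⊓ m
suc-⊓ zero    m       = refl
suc-⊓ (suc a) zero    = cong suc (⊓-zeroʳ a)
suc-⊓ (suc a) (suc m) =
  trans (cong suc (suc-⊓ a m)) (sym (+-suc (if m <ᵇ a then 1 else 0) (a ⊓ m)))

forward-out : ∀ a (v : Fin n) →
  ∑ (λ (w : Fin n) → contribution 1ℙ a (index v) (index w)) ≡ a ⊓ (n ∸ index v)
forward-out {suc n} a zero    = count-< n a
forward-out {suc n} a (suc v) = forward-out a v

forward-in : ∀ a (v : Fin n) →
  ∑ (λ (u : Fin n) → contribution 1ℙ a (index u) (index v)) ≡ a ⊓ toℕ v
forward-in {suc n} a zero    = trans (∑-zero n) (sym (⊓-zeroʳ a))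
forward-in {suc n} a (suc v) =
  trans (cong ((if toℕ v <ᵇ a then 1 else 0) +_) (forward-in a v)) (sym (suc-⊓ a (toℕ v)))

backward≡forward : ∀ a i j → contribution 0ℙ a i j ≡ contribution 1ℙ a j i
backward≡forward a i j = cong (λ b → if (j <ᵇ i) ∧ b then 1 else 0)
  (does-⇔ (mk⇔ (λ i∸a≤j → subst (i ≤_) (+-comm a j)
                             (≤-trans (m≤n+m∸n i a) (+-monoʳ-≤ a i∸a≤j)))
               (λ i≤j+a → m≤n+o⇒m∸n≤o i a (subst (i ≤_) (+-comm j a) i≤j+a)))
          (i ∸ a ≤? j) (i ≤? j + a))

backward-out : ∀ a (v : Fin n) →
  ∑ (λ (w : Fin n) → contribution 0ℙ a (index v) (index w)) ≡ a ⊓ toℕ v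
backward-out {n} a v = trans
  (∑-cong (λ (w : Fin n) → backward≡forward a (index v) (index w)))
  (forward-in a v)

backward-in : ∀ a (v : Fin n) →
  ∑ (λ (u : Fin n) → contribution 0ℙ a (index u) (index v)) ≡ a ⊓ (n ∸ index v)
backward-in {n} a v = trans
  (∑-cong (λ (u : Fin n) → backward≡forward a (index u) (index v)))
  (forward-out a v)

entry-degree : ∀ p a (v : Fin n) →
  ∑ (λ (w : Fin n) → contribution p a (index v) (index w)) +
  ∑ (λ (u : Fin n) → contribution p a (index u) (index v)) ≡
  a ⊓ toℕ v + a ⊓ (n ∸ index v)
entry-degree {n} 1ℙ a v =
  trans (cong₂ _+_ (forward-out a v) (forward-in a v))
        (+-comm (a ⊓ (n ∸ index v)) (a ⊓ toℕ v))
entry-degree 0ℙ a v = cong₂ _+_ (backward-out a v) (backward-in a v)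

reach : OrderedString l → ℕ → ℕ
reach s m = ∑ (λ t → lookup s t ⊓ m)

total : OrderedString l → ℕ
total s = ∑ (lookup s)

degree-ornated : (s : OrderedString l) (v : Fin n) →
  degree (ornated n s) v ≡ reach s (toℕ v) + reach s (n ∸ index v)
degree-ornated {l} {n} s v = begin
  ∑ (λ w → ∑ (λ t → arcs t v w)) + ∑ (λ u → ∑ (λ t → arcs t u v))
    ≡⟨ cong₂ _+_ (∑-comm M (λ w t → arcs t v w)) (∑-comm M (λ u t → arcs t u v)) ⟩
  ∑ (λ t → ∑ (λ w → arcs t v w)) + ∑ (λ t → ∑ (λ u → arcs t u v))
    ≡⟨ ∑-distrib-+ M (λ t → ∑ (λ w → arcs t v w)) (λ t → ∑ (λ u → arcs t u v)) ⟨
  ∑ (λ t → ∑ (λ w → arcs t v w) + ∑ (λ u → arcs t u v))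
    ≡⟨ ∑-cong (λ t → entry-degree (parity (index t)) (lookup s t) v) ⟩
  ∑ (λ t → lookup s t ⊓ toℕ v + lookup s t ⊓ (n ∸ index v))
    ≡⟨ ∑-distrib-+ M (λ t → lookup s t ⊓ toℕ v) (λ t → lookup s t ⊓ (n ∸ index v)) ⟩
  reach s (toℕ v) + reach s (n ∸ index v) ∎
  where
  open ≡-Reasoning
  M = +-0-commutativeMonoid
  arcs : Fin l → Fin n → Fin n → ℕ
  arcs t u w = contribution (parity (index t)) (lookup s t) (index u) (index w)

module _ (s : OrderedString l) where

  reach-zero : reach s 0 ≡ 0
  reach-zero = trans (∑-cong (λ t → ⊓-zeroʳ (lookup s t))) (∑-zero l)

  reach-mono : ∀ {m m′} → m ≤ m′ → reach s m ≤ reach s m′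
  reach-mono m≤m′ = ∑-mono-≤ (λ t → ⊓-monoʳ-≤ (lookup s t) m≤m′)

  reach≤total : ∀ m → reach s m ≤ total s
  reach≤total m = ∑-mono-≤ (λ t → m⊓n≤m (lookup s t) m)

  reach-total : reach s (total s) ≡ total s
  reach-total = ∑-cong (λ t → m≤n⇒m⊓n≡m (term≤∑ (lookup s) t))

  Saturated : ℕ → Set
  Saturated m = reach s m ≡ total s

  saturated-mono : ∀ {m m′} → m ≤ m′ → Saturated m → Saturated m′
  saturated-mono m≤m′ sat =
    ≤-antisym (reach≤total _) (≤-trans (≤-reflexive (sym sat)) (reach-mono m≤m′))

  degree-saturated : ∀ {n p} → p < n → Saturated p → Saturated (n ∸ suc p) →
                     HasVertexOfDegree (ornated n s) (total s + total s)
  degree-saturated {n} {p} p<n satˡ satʳ = fromℕ< p<n ,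
    trans (degree-ornated s (fromℕ< p<n))
      (subst (λ i → reach s i + reach s (n ∸ suc i) ≡ total s + total s)
             (sym (toℕ-fromℕ< p<n)) (cong₂ _+_ satˡ satʳ))

  degree≤2total : ∀ (v : Fin n) → degree (ornated n s) v ≤ total s + total s
  degree≤2total v = ≤-trans (≤-reflexive (degree-ornated s v))
    (+-mono-≤ (reach≤total (toℕ v)) (reach≤total _))

  2total≤maxPossible : ∀ {D} → IsMaxPossibleDegree s D → total s + total s ≤ D
  2total≤maxPossible (_ , Δ≤D)
    with v , dv ← degree-saturated {suc (total s + total s)} (s≤s (m≤m+n _ _))
                    reach-total
                    (trans (cong (reach s) (m+n∸n≡m (total s) (total s))) reach-total)
    = ≤-trans (≤-reflexive (sym dv))
        (≤-trans (degree≤Δ (ornated _ s) v) (Δ≤D (suc (total s + total s))))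

  saturated-around : ∀ (v : Fin n) → total s + total s ≤ degree (ornated n s) v →
                     Saturated (toℕ v) × Saturated (n ∸ index v)
  saturated-around {n} v 2S≤dv =
      ≤-antisym (reach≤total _) (+-cancelʳ-≤ (total s) _ _
        (≤-trans 2S≤r+r (+-monoʳ-≤ (reach s (toℕ v)) (reach≤total _))))
    , ≤-antisym (reach≤total _) (+-cancelˡ-≤ (total s) _ _
        (≤-trans 2S≤r+r (+-monoˡ-≤ (reach s (n ∸ index v)) (reach≤total _))))
    where
    2S≤r+r : total s + total s ≤ reach s (toℕ v) + reach s (n ∸ index v)
    2S≤r+r = subst (total s + total s ≤_) (degree-ornated s v) 2S≤dv

  total≤degree : ∀ {n p q} → p + q < n → Saturated p → Saturated q →
                 ∀ (w : Fin n) → total s ≤ degree (ornated n s) w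
  total≤degree {n} {p} {q} p+q<n satˡ satʳ w
    rewrite degree-ornated s w with ≤-total p (toℕ w)
  ... | inj₁ p≤w = m≤n⇒m≤n+o _ (≤-reflexive (sym (saturated-mono p≤w satˡ)))
  ... | inj₂ w≤p = m≤n⇒m≤o+n _ (≤-reflexive (sym (saturated-mono q≤ satʳ)))
    where
    q≤ : q ≤ n ∸ index w
    q≤ = m+n≤o⇒m≤o∸n q (≤-trans (≤-reflexive (+-comm q _))
                          (≤-trans (s≤s (+-monoˡ-≤ q w≤p)) p+q<n))

  Δ≡2δ : ∀ {n p q} .{{_ : NonZero n}} → p + q < n → Saturated p → Saturated q →
         Δ (ornated n s) ≡ 2 * δ (ornated n s)
  Δ≡2δ {suc m} {p} {q} p+q<n satˡ satʳ = begin
    Δ G                ≡⟨ Δ≡degree G v degree≤dv ⟩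
    degree G v         ≡⟨ dv ⟩
    total s + total s  ≡⟨ cong (total s +_) (+-identityʳ (total s)) ⟨
    2 * total s        ≡⟨ cong (2 *_) d₁ ⟨
    2 * degree G zero  ≡⟨ cong (2 *_) (δ≡degree G zero d₁≤degree) ⟨
    2 * δ G            ∎
    where
    open ≡-Reasoning
    G = ornated (suc m) s

    p≤m : p ≤ m
    p≤m = m+n≤o⇒m≤o p (s≤s⁻¹ p+q<n)

    maximal : HasVertexOfDegree G (total s + total s)
    maximal = degree-saturated (s≤s p≤m) satˡ
      (saturated-mono (m+n≤o⇒m≤o∸n q (subst (_≤ m) (+-comm p q) (s≤s⁻¹ p+q<n))) satʳ)

    v = proj₁ maximal
    dv = proj₂ maximal

    d₁ : degree G zero ≡ total s
    d₁ = trans (degree-ornated s zero) (cong₂ _+_ reach-zero (saturated-mono p≤m satˡ))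

    degree≤dv : ∀ w → degree G w ≤ degree G v
    degree≤dv w = ≤-trans (degree≤2total w) (≤-reflexive (sym dv))

    d₁≤degree : ∀ w → degree G zero ≤ degree G w
    d₁≤degree w = ≤-trans (≤-reflexive d₁) (total≤degree p+q<n satˡ satʳ w)

corollary2p13 :
    ∀ (l : ℕ) .{{_ : NonZero l}} (s : OrderedString l)
      (k : ℕ) → IsKyleOrder s k →
    ∀ (n : ℕ) .{{_ : NonZero n}} → n ≥ k →
    Δ (ornated n s) ≡ 2 * δ (ornated n s)
corollary2p13 l s k (D , isMax , (v , dv) , _) n n≥k =
  Δ≡2δ s (≤-trans (≤-reflexive (m+[n∸m]≡n (toℕ<n v))) n≥k)
    (proj₁ saturated) (proj₂ saturated)
  where
  saturated = saturated-around s v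
    (≤-trans (2total≤maxPossible s isMax) (≤-reflexive (sym dv)))
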